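{- Let $\sigma,n\ge2$ be integers with $\sigma\le n$. Any data structure supporting inverse suffix array queries for every text $T\in[0..\sigma)^n$ has worst-case space usage $\Omega(n\log\sigma)$ bits; that is, there is an absolute constant $\delta>0$ such that for all integers $2\le\sigma\le n$, any such data structure uses at least $\delta\,n\log\sigma$ bits on some $T\in[0..\sigma)^n$.
   Context: Here $[0..\sigma)=\{0,\dots,\sigma-1\}$ and $\log$ is base 2. For a text $T$ of length $n$, the suffix array $\mathrm{SA}_T[1..n]$ is the permutation of $\{1,\dots,n\}$ such that $T[\mathrm{SA}_T[1]..n]\prec\cdots\prec T[\mathrm{SA}_T[n]..n]$ lexicographically (a proper prefix of a string precedes that string), and $\mathrm{SA}^{ -1}_T$ is the inverse permutation. An inverse suffix array query takes $j\in\{1,\dots,n\}$ and returns $\mathrm{SA}^{ -1}_T[j]$. A data structure supporting a query problem for a family of inputs (with parameters $\sigma,n$ fixed) assigns to each input a finite bit string; the answer to every query on an input is determined by the stored bit string and the query arguments only. The space used on an input is the length of its bit string, and the worst-case space usage is the maximum over all inputs in the family. Query time is irrelevant. -}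

module Defs where

open import Data.Bool.Base using (Bool)
open import Data.Fin.Base as Fin using (Fin; zero; suc; toℕ; fromℕ<; punchOut)
import Data.Fin.Properties as Fin
open import Data.Fin.Permutation using (Permutation′; permutation; _⟨$⟩ʳ_; _⟨$⟩ˡ_; inverseˡ; inverseʳ)
open import Data.Fin.Subset using (Subset; _∈_; ∣_∣)
open import Data.Fin.Subset.Properties using (∈⊤; ∣⊤∣≡n; p⊂q⇒∣p∣<∣q∣)
open import Data.Integer.Base using (+_; -[1+_])
open import Data.List.Base using (List; drop; length)
open import Data.List.Relation.Binary.Lex.Strict using (Lex-<; <-decidable; <-transitive; <-irreflexive; <-compare)
open import Data.List.Relation.Binary.Pointwise using (≡⇒Pointwise-≡; Pointwise-≡⇒≡)
import Data.List.Properties as List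
open import Data.Nat.Base as ℕ using (ℕ; zero; suc; _^_)
import Data.Nat.Properties as ℕ
open import Data.Product.Base using (∃; _,_; proj₁; proj₂)
open import Data.Rational.Unnormalised.Base using (ℚᵘ; mkℚᵘ)
open import Data.Vec.Base using (Vec; toList; tabulate)
open import Data.Vec.Properties using (length-toList; lookup∘tabulate; []=⇒lookup; lookup⇒[]=)
open import Function.Base using (_∘_)
open import Function.Definitions using (Injective)
open import Relation.Binary.Definitions using (tri<; tri≈; tri>; Transitive; Decidable)
open import Relation.Binary.PropositionalEquality
  using (_≡_; _≢_; refl; sym; trans; cong; subst; subst₂; resp₂; isEquivalence; module ≡-Reasoning)
open import Relation.Nullary using (¬_; yes; no; does; contradiction)
open import Relation.Nullary.Decidable using (dec-true; dec-false)

-- Positions and ranks are 0-based: i : Fin n stands for toℕ i + 1 in {1,…,n}.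

Text : ℕ → ℕ → Set
Text σ n = Vec (Fin σ) n

suffix : ∀ {σ n} → Text σ n → Fin n → List (Fin σ)
suffix T i = drop (toℕ i) (toList T)

infix 4 _≺_

_≺_ : ∀ {σ} → List (Fin σ) → List (Fin σ) → Set
_≺_ = Lex-< _≡_ Fin._<_

IsSuffixArray : ∀ {σ n} → Text σ n → Permutation′ n → Set
IsSuffixArray T π = ∀ {i j} → i Fin.< j → suffix T (π ⟨$⟩ʳ i) ≺ suffix T (π ⟨$⟩ʳ j)

≺-trans : ∀ {σ} → Transitive (_≺_ {σ})
≺-trans = <-transitive isEquivalence (resp₂ Fin._<_) Fin.<-trans

≺-irrefl : ∀ {σ} {x : List (Fin σ)} → ¬ (x ≺ x)
≺-irrefl = <-irreflexive Fin.<-irrefl (≡⇒Pointwise-≡ refl)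

_≺?_ : ∀ {σ} → Decidable (_≺_ {σ})
_≺?_ = <-decidable Fin._≟_ Fin._<?_

suffix-injective : ∀ {σ n} (T : Text σ n) → Injective _≡_ _≡_ (suffix T)
suffix-injective {n = n} T {i} {j} eq = Fin.toℕ-injective
  (ℕ.∸-cancelˡ-≡ (Fin.toℕ≤n i) (Fin.toℕ≤n j) (begin
    n ℕ.∸ toℕ i          ≡⟨ len i ⟨
    length (suffix T i)  ≡⟨ cong length eq ⟩
    length (suffix T j)  ≡⟨ len j ⟩
    n ℕ.∸ toℕ j          ∎))
  where
  open ≡-Reasoning
  len : ∀ k → length (suffix T k) ≡ n ℕ.∸ toℕ k
  len k = trans (List.length-drop (toℕ k) (toList T))
                (cong (ℕ._∸ toℕ k) (length-toList T))

injective⇒preimage : ∀ {n} (f : Fin n → Fin n) → Injective _≡_ _≡_ f →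
                     ∀ i → ∃ λ j → f j ≡ i
injective⇒preimage {suc n} f inj i with Fin.any? (λ j → f j Fin.≟ i)
... | yes p = p
... | no ¬p = contradiction (Fin.injective⇒≤ g-injective) ℕ.1+n≰n
  where
  i≢f : ∀ j → i ≢ f j
  i≢f j eq = ¬p (j , sym eq)
  g : Fin (suc n) → Fin n
  g j = punchOut (i≢f j)
  g-injective : Injective _≡_ _≡_ g
  g-injective {j} {k} = inj ∘ Fin.punchOut-injective (i≢f j) (i≢f k)

module Rank {σ n} (T : Text σ n) where

  below : Fin n → Subset n
  below j = tabulate (λ k → does (suffix T k ≺? suffix T j))

  ∈-below : ∀ j k → suffix T k ≺ suffix T j → k ∈ below j
  ∈-below j k lt = lookup⇒[]= k (below j)
    (trans (lookup∘tabulate _ k) (dec-true (suffix T k ≺? suffix T j) lt))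

  below-∈ : ∀ j k → k ∈ below j → suffix T k ≺ suffix T j
  below-∈ j k k∈ with suffix T k ≺? suffix T j
  ... | yes lt = lt
  ... | no ≮ with () ← trans (sym (dec-false (suffix T k ≺? suffix T j) ≮))
                           (trans (sym (lookup∘tabulate _ k)) ([]=⇒lookup k∈))

  rank< : ∀ j → ∣ below j ∣ ℕ.< n
  rank< j = subst (∣ below j ∣ ℕ.<_) (∣⊤∣≡n n)
    (p⊂q⇒∣p∣<∣q∣ ((λ _ → ∈⊤) , j , ∈⊤ , ≺-irrefl ∘ below-∈ j j))

  rank : Fin n → Fin n
  rank j = fromℕ< (rank< j)

  rank-mono : ∀ j k → suffix T j ≺ suffix T k → rank j Fin.< rank k
  rank-mono j k lt = subst₂ ℕ._<_
    (sym (Fin.toℕ-fromℕ< (rank< j))) (sym (Fin.toℕ-fromℕ< (rank< k)))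
    (p⊂q⇒∣p∣<∣q∣
      ( (λ {x} x∈ → ∈-below k x (≺-trans (below-∈ j x x∈) lt))
      , j , ∈-below k j lt , ≺-irrefl ∘ below-∈ j j))

  rank-reflects : ∀ j k → rank j Fin.< rank k → suffix T j ≺ suffix T k
  rank-reflects j k lt
    with <-compare sym Fin.<-cmp (suffix T j) (suffix T k)
  ... | tri< l _ _ = l
  ... | tri≈ _ e _ = contradiction lt
    (Fin.<-irrefl (cong rank (suffix-injective T {j} {k} (Pointwise-≡⇒≡ e))))
  ... | tri> _ _ g = contradiction (rank-mono k j g) (Fin.<-asym lt)

  rank-injective : Injective _≡_ _≡_ rank
  rank-injective {j} {k} eq
    with <-compare sym Fin.<-cmp (suffix T j) (suffix T k)
  ... | tri< l _ _ = contradiction (rank-mono j k l) (Fin.<-irrefl eq)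
  ... | tri≈ _ e _ = suffix-injective T (Pointwise-≡⇒≡ e)
  ... | tri> _ _ g = contradiction (rank-mono k j g) (Fin.<-irrefl (sym eq))

  unrank : Fin n → Fin n
  unrank i = proj₁ (injective⇒preimage rank rank-injective i)

  rank-unrank : ∀ i → rank (unrank i) ≡ i
  rank-unrank i = proj₂ (injective⇒preimage rank rank-injective i)

  sa : Permutation′ n
  sa = permutation unrank rank
    (λ j → rank-injective (rank-unrank (rank j)))
    rank-unrank

suffixArray : ∀ {σ n} (T : Text σ n) → ∃ (IsSuffixArray T)
suffixArray T = sa , λ {i} {j} i<j → rank-reflects (unrank i) (unrank j)
  (subst₂ Fin._<_ (sym (rank-unrank i)) (sym (rank-unrank j)) i<j)
  where open Rank T

suffixArray-unique : ∀ {σ n} (T : Text σ n) {π ρ : Permutation′ n} →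
                     IsSuffixArray T π → IsSuffixArray T ρ →
                     ∀ i → π ⟨$⟩ʳ i ≡ ρ ⟨$⟩ʳ i
suffixArray-unique {n = n} T {π} {ρ} isπ isρ i =
  trans (sym (inverseʳ ρ)) (cong (ρ ⟨$⟩ʳ_) (mono⇒id f f-mono i))
  where
  f : Fin n → Fin n
  f i = ρ ⟨$⟩ˡ (π ⟨$⟩ʳ i)

  f-mono : ∀ {i j} → i Fin.< j → f i Fin.< f j
  f-mono {i} {j} i<j with Fin.<-cmp (f i) (f j)
  ... | tri< l _ _ = l
  ... | tri≈ _ e _ = contradiction i<j (Fin.<-irrefl
    (trans (sym (inverseˡ π)) (trans (cong (π ⟨$⟩ˡ_)
      (trans (sym (inverseʳ ρ)) (trans (cong (ρ ⟨$⟩ʳ_) e) (inverseʳ ρ)))) (inverseˡ π))))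
  ... | tri> _ _ g = contradiction
    (≺-trans (isπ i<j) (subst₂ (λ a b → suffix T a ≺ suffix T b) (inverseʳ ρ) (inverseʳ ρ) (isρ g)))
    ≺-irrefl

  mono⇒id : ∀ {n} (g : Fin n → Fin n) → (∀ {i j} → i Fin.< j → g i Fin.< g j) →
            ∀ i → g i ≡ i
  mono⇒id {n} g mono i = Fin.toℕ-injective
    (ℕ.≤-antisym (upper (n ℕ.∸ toℕ i) i ℕ.≤-refl) (lower (toℕ i) i refl))
    where
    lower : ∀ m i → toℕ i ≡ m → m ℕ.≤ toℕ (g i)
    lower zero    i _  = ℕ.z≤n
    lower (suc m) i eq = ℕ.≤-<-trans (lower m k tk) (mono (subst₂ ℕ._<_ (sym tk) (sym eq) ℕ.≤-refl))
      where
      m<n : m ℕ.< n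
      m<n = ℕ.<-trans (ℕ.n<1+n m) (subst (ℕ._< n) eq (Fin.toℕ<n i))
      k = fromℕ< m<n
      tk : toℕ k ≡ m
      tk = Fin.toℕ-fromℕ< m<n

    upper : ∀ d i → n ℕ.∸ toℕ i ℕ.≤ d → toℕ (g i) ℕ.≤ toℕ i
    upper zero    i le = contradiction (ℕ.m∸n≡0⇒m≤n (ℕ.n≤0⇒n≡0 le)) (ℕ.<⇒≱ (Fin.toℕ<n i))
    upper (suc d) i le with suc (toℕ i) ℕ.<? n
    ... | yes lt = ℕ.s≤s⁻¹ (ℕ.<-≤-trans
            (mono (subst (toℕ i ℕ.<_) (sym tk) ℕ.≤-refl))
            (subst (toℕ (g k) ℕ.≤_) tk
              (upper d k (subst (λ t → n ℕ.∸ t ℕ.≤ d) (sym tk)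
                (subst (ℕ._≤ d) (ℕ.pred[m∸n]≡m∸[1+n] n (toℕ i)) (ℕ.pred-mono-≤ le))))))
      where
      k = fromℕ< lt
      tk = Fin.toℕ-fromℕ< lt
    ... | no ≮n = ℕ.s≤s⁻¹ (ℕ.<-≤-trans (Fin.toℕ<n (g i)) (ℕ.≮⇒≥ ≮n))

SA : ∀ {σ n} → Text σ n → Permutation′ n
SA T = proj₁ (suffixArray T)

SA⁻¹ : ∀ {σ n} → Text σ n → Fin n → Fin n
SA⁻¹ T j = SA T ⟨$⟩ˡ j

record DataStructure {Input Query Answer : Set}
                     (spec : Input → Query → Answer) : Set where
  field
    encode  : Input → List Bool
    answer  : List Bool → Query → Answer
    correct : ∀ x q → answer (encode x) q ≡ spec x q

  space : Input → ℕ
  space x = length (encode x)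

ISADataStructure : (σ n : ℕ) → Set
ISADataStructure σ n = DataStructure (SA⁻¹ {σ} {n})

infix 4 _*log₂_≤_

-- q *log₂ x ≤ m is the inequality q · log₂ x ≤ m between real numbers,
-- for rational q and x ≥ 1: multiply by the denominator of q, apply
-- t ↦ 2ᵗ, and move a negative power of x to the other side.

_*log₂_≤_ : ℚᵘ → ℕ → ℕ → Set
mkℚᵘ (+ p)    d-1 *log₂ x ≤ m = x ^ p ℕ.≤ 2 ^ (suc d-1 ℕ.* m)
mkℚᵘ -[1+ p ] d-1 *log₂ x ≤ m = 1 ℕ.≤ 2 ^ (suc d-1 ℕ.* m) ℕ.* x ^ suc p

{-# OPTIONS --safe #-}

-- End the text with the reference symbols 1, 3, …, 2k − 1, where k = ⌊σ/2⌋, and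
-- let the first n − k symbols range freely over the k + 1 symbols
-- 0, 2, …, 2k − 2 and 2k − 1.  The rank of a free position relative to the
-- ranks of the reference positions determines its symbol: the only possible tie
-- of first symbols is with the last reference, and the suffix of length one is
-- the least one starting with its symbol.  So (k + 1)^(n − k) ≥ σ^(n / 4) texts
-- have distinct inverse suffix arrays and need distinct codes.

module Submission where

open import Defs
open import Data.Bool.Base using (Bool; true; false)
open import Data.Fin.Base as Fin using (Fin; zero; suc; toℕ; fromℕ<; finToFun;
  funToFin; combine; _↑ˡ_; _↑ʳ_)
import Data.Fin.Properties as Fin
open import Data.Integer.Base using (+_; +<+)
import Data.Integer.Properties as ℤ
open import Data.List.Base using (List; []; _∷_; length; drop)
open import Data.List.Properties using (drop-all)
open import Data.List.Relation.Binary.Lex.Strict using (halt; this; next)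
open import Data.Nat.Base as ℕ using (ℕ; zero; suc; _≤_; _^_; z≤n; s≤s)
open import Data.Nat.Binary.Base as Bin using (ℕᵇ; 2[1+_]; 1+[2_])
import Data.Nat.Binary.Properties as Bin
open import Data.Nat.DivMod using (m/n*n≤m; m≡m%n+[m/n]*n; m%n<n; m≥n⇒m/n>0)
import Data.Nat.Properties as ℕ
open import Data.Nat.Tactic.RingSolver using (solve-∀)
open import Data.Product.Base using (∃; ∃-syntax; _×_; _,_)
open import Data.Rational.Unnormalised.Base using (ℚᵘ; mkℚᵘ; 0ℚᵘ; _<_; _*_; _/_; *<*)
open import Data.Sum.Base using (inj₁; inj₂)
open import Data.Vec.Base using (_∷_; _++_; lookup; tabulate; toList)
open import Data.Vec.Properties using (length-toList; lookup∘tabulate; lookup-++ˡ; lookup-++ʳ)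
open import Function.Base using (_∘_)
open import Function.Definitions using (Injective)
open import Relation.Binary.PropositionalEquality
  using (_≡_; _≗_; refl; sym; trans; cong; cong₂; subst; subst₂; module ≡-Reasoning)
open import Relation.Nullary using (yes; no; contradiction)

-- Counting bit strings by length.

-- Bijective base-2 numeration.
fromBits : List Bool → ℕᵇ
fromBits []           = Bin.zero
fromBits (false ∷ bs) = 1+[2 fromBits bs ]
fromBits (true  ∷ bs) = 2[1+ fromBits bs ]

fromBits-injective : Injective _≡_ _≡_ fromBits
fromBits-injective {[]}        {[]}        _  = refl
fromBits-injective {false ∷ _} {false ∷ _} eq =
  cong (false ∷_) (fromBits-injective (Bin.1+[2_]-injective eq))
fromBits-injective {true ∷ _}  {true ∷ _}  eq =
  cong (true ∷_) (fromBits-injective (Bin.2[1+_]-injective eq))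
fromBits-injective {[]}        {false ∷ _} ()
fromBits-injective {[]}        {true ∷ _}  ()
fromBits-injective {false ∷ _} {[]}        ()
fromBits-injective {false ∷ _} {true ∷ _}  ()
fromBits-injective {true ∷ _}  {[]}        ()
fromBits-injective {true ∷ _}  {false ∷ _} ()

-- The numeration lists strings by length, so those of length at most l take exactly the values 0,
-- ..., 2^(l + 1) - 2. Strings of `true` attain equality.
toℕ-fromBits-bound : ∀ bs → 2 ℕ.+ Bin.toℕ (fromBits bs) ≤ 2 ^ suc (length bs)
toℕ-fromBits-bound []           = ℕ.≤-refl
toℕ-fromBits-bound (false ∷ bs) = begin
  3 ℕ.+ 2 ℕ.* x       ≤⟨ ℕ.n≤1+n _ ⟩
  4 ℕ.+ 2 ℕ.* x       ≡⟨ ℕ.*-distribˡ-+ 2 2 x ⟨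
  2 ℕ.* (2 ℕ.+ x)     ≤⟨ ℕ.*-monoʳ-≤ 2 (toℕ-fromBits-bound bs) ⟩
  2 ^ suc (suc (length bs)) ∎
  where
  open ℕ.≤-Reasoning
  x = Bin.toℕ (fromBits bs)
toℕ-fromBits-bound (true ∷ bs)  = begin
  2 ℕ.+ 2 ℕ.* suc x   ≡⟨ ℕ.*-distribˡ-+ 2 1 (suc x) ⟨
  2 ℕ.* (2 ℕ.+ x)     ≤⟨ ℕ.*-monoʳ-≤ 2 (toℕ-fromBits-bound bs) ⟩
  2 ^ suc (suc (length bs)) ∎
  where
  open ℕ.≤-Reasoning
  x = Bin.toℕ (fromBits bs)

-- Pigeonhole: if every string were too short, all codes would lie below `N`. The strict inequality
-- later excludes an empty code.
injective⇒long : ∀ {N} (f : Fin (suc N) → List Bool) → Injective _≡_ _≡_ f →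
                 ∃ λ x → suc N ℕ.< 2 ^ suc (length (f x))
injective⇒long {N} f f-injective with Fin.any? (λ x → suc N ℕ.<? 2 ^ suc (length (f x)))
... | yes p = p
... | no ¬p = contradiction (Fin.injective⇒≤ code-injective) ℕ.1+n≰n
  where
  code<N : ∀ x → Bin.toℕ (fromBits (f x)) ℕ.< N
  code<N x = ℕ.s≤s⁻¹ (ℕ.≤-trans (toℕ-fromBits-bound (f x)) (ℕ.≮⇒≥ (¬p ∘ (x ,_))))

  code : Fin (suc N) → Fin N
  code x = fromℕ< (code<N x)

  code-injective : Injective _≡_ _≡_ code
  code-injective {x} {y} eq = f-injective (fromBits-injective (Bin.toℕ-injective
    (Fin.fromℕ<-injective _ _ (code<N x) (code<N y) eq)))

-- Functions between finite sets as numbers.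

-- Stands in for function extensionality.
funToFin-cong : ∀ {m n} {f g : Fin m → Fin n} → f ≗ g → funToFin f ≡ funToFin g
funToFin-cong {zero}  _   = refl
funToFin-cong {suc m} f≗g = cong₂ combine (f≗g zero) (funToFin-cong (f≗g ∘ suc))

finToFun-injective : ∀ {m n} {x y : Fin (m ^ n)} → finToFun {m} {n} x ≗ finToFun y → x ≡ y
finToFun-injective {m} {n} {x} {y} eq = begin
  x                              ≡⟨ Fin.funToFin-finToFin {n} {m} x ⟨
  funToFin (finToFun {m} {n} x)  ≡⟨ funToFin-cong eq ⟩
  funToFin (finToFun {m} {n} y)  ≡⟨ Fin.funToFin-finToFin {n} {m} y ⟩
  y                              ∎
  where open ≡-Reasoning

-- Comparison of suffixes, and what a code determines.

suffix-uncons : ∀ {σ n} (T : Text σ n) i →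
                suffix T i ≡ lookup T i ∷ drop (suc (toℕ i)) (toList T)
suffix-uncons (_ ∷ _) zero    = refl
suffix-uncons (_ ∷ T) (suc i) = suffix-uncons T i

lookup-<⇒≺ : ∀ {σ n} (T : Text σ n) i j → lookup T i Fin.< lookup T j →
             suffix T i ≺ suffix T j
lookup-<⇒≺ T i j lt =
  subst₂ _≺_ (sym (suffix-uncons T i)) (sym (suffix-uncons T j)) (this lt)

-- The suffix at `j` is a single symbol, hence a proper prefix of the longer suffix at `i`.
last-≺ : ∀ {σ n} (T : Text σ n) i j → suc (toℕ j) ≡ n → i Fin.< j →
         lookup T j ≡ lookup T i → suffix T j ≺ suffix T i
last-≺ {n = n} T i j last i<j eq = subst₂ _≺_ (sym suffix-j) (sym suffix-i) (next eq halt)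
  where
  open ≡-Reasoning
  1+i<n : suc (toℕ i) ℕ.< n
  1+i<n = subst (suc (toℕ i) ℕ.<_) last (s≤s i<j)

  i⁺ : Fin n
  i⁺ = fromℕ< 1+i<n

  suffix-j : suffix T j ≡ lookup T j ∷ []
  suffix-j = trans (suffix-uncons T j) (cong (lookup T j ∷_)
    (drop-all (suc (toℕ j)) (toList T) (ℕ.≤-reflexive (trans (length-toList T) (sym last)))))

  suffix-i : suffix T i ≡ lookup T i ∷ lookup T i⁺ ∷ drop (suc (toℕ i⁺)) (toList T)
  suffix-i = trans (suffix-uncons T i) (cong (lookup T i ∷_) (begin
    drop (suc (toℕ i)) (toList T)  ≡⟨ cong (λ d → drop d (toList T)) (Fin.toℕ-fromℕ< 1+i<n) ⟨
    suffix T i⁺                    ≡⟨ suffix-uncons T i⁺ ⟩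
    _                              ∎))

encode-reflects-SA⁻¹ : ∀ {σ n} (D : ISADataStructure σ n) {T U : Text σ n} →
                       DataStructure.encode D T ≡ DataStructure.encode D U → SA⁻¹ T ≗ SA⁻¹ U
encode-reflects-SA⁻¹ D {T} {U} eq j = begin
  SA⁻¹ T j                ≡⟨ correct T j ⟨
  answer (encode T) j     ≡⟨ cong (λ c → answer c j) eq ⟩
  answer (encode U) j     ≡⟨ correct U j ⟩
  SA⁻¹ U j                ∎
  where
  open ≡-Reasoning
  open DataStructure D

-- The family of texts with reference symbols.

-- p is k − 1.
module References {σ p : ℕ} (bound : suc p ℕ.* 2 ≤ σ) where

  reference-< : ∀ (b : Fin (suc p)) → suc (toℕ b ℕ.* 2) ℕ.< σ
  reference-< b = ℕ.≤-trans (ℕ.*-monoˡ-≤ 2 (Fin.toℕ<n b)) bound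

  reference : Fin (suc p) → Fin σ
  reference b = fromℕ< (reference-< b)

  toℕ-reference : ∀ b → toℕ (reference b) ≡ suc (toℕ b ℕ.* 2)
  toℕ-reference b = Fin.toℕ-fromℕ< (reference-< b)

  -- The minimum matters only at the top index `suc p`: there it gives 2k - 1, the last reference
  -- symbol, instead of 2k, which need not be below `σ`.
  free-< : ∀ (a : Fin (suc (suc p))) → toℕ a ℕ.* 2 ℕ.⊓ suc (p ℕ.* 2) ℕ.< σ
  free-< a = ℕ.≤-trans (s≤s (ℕ.m⊓n≤n (toℕ a ℕ.* 2) _)) bound

  free : Fin (suc (suc p)) → Fin σ
  free a = fromℕ< (free-< a)

  toℕ-free : ∀ a → toℕ (free a) ≡ toℕ a ℕ.* 2 ℕ.⊓ suc (p ℕ.* 2)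
  toℕ-free a = Fin.toℕ-fromℕ< (free-< a)

  free<reference : ∀ a b → toℕ a ≤ toℕ b → free a Fin.< reference b
  free<reference a b a≤b = subst₂ ℕ._<_ (sym (toℕ-free a)) (sym (toℕ-reference b))
    (s≤s (ℕ.≤-trans (ℕ.m⊓n≤m _ _) (ℕ.*-monoˡ-≤ 2 a≤b)))

  reference≤free : ∀ a b → toℕ b ℕ.< toℕ a → reference b Fin.≤ free a
  reference≤free a b b<a = subst₂ _≤_ (sym (toℕ-reference b)) (sym (toℕ-free a))
    (ℕ.⊓-glb (ℕ.≤-trans (ℕ.n≤1+n _) (ℕ.*-monoˡ-≤ 2 b<a))
             (s≤s (ℕ.*-monoˡ-≤ 2 (ℕ.s≤s⁻¹ (Fin.toℕ<n b)))))

  -- For `toℕ b` below `p`, both arguments of the minimum defining `free a` exceed 2b + 1, so no tie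
  -- occurs.
  reference≡free⇒last : ∀ a b → toℕ b ℕ.< toℕ a → reference b ≡ free a → toℕ b ≡ p
  reference≡free⇒last a b b<a eq = ℕ.≤-antisym (ℕ.s≤s⁻¹ (Fin.toℕ<n b)) (ℕ.≮⇒≥ λ b<p →
    ℕ.<-irrefl (trans (sym (toℕ-reference b)) (trans (cong toℕ eq) (toℕ-free a)))
      (ℕ.⊓-glb (ℕ.*-monoˡ-≤ 2 b<a)
               (ℕ.≤-trans (ℕ.*-monoˡ-≤ 2 b<p) (ℕ.n≤1+n _))))

  module _ {m : ℕ} where

    text : (Fin m → Fin (suc (suc p))) → Text σ (m ℕ.+ suc p)
    text w = tabulate (free ∘ w) ++ tabulate reference

    lookup-free : ∀ w i → lookup (text w) (i ↑ˡ suc p) ≡ free (w i)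
    lookup-free w i = trans (lookup-++ˡ (tabulate (free ∘ w)) (tabulate reference) i)
                            (lookup∘tabulate (free ∘ w) i)

    lookup-reference : ∀ w b → lookup (text w) (m ↑ʳ b) ≡ reference b
    lookup-reference w b = trans (lookup-++ʳ (tabulate (free ∘ w)) (tabulate reference) b)
                                 (lookup∘tabulate reference b)

    ↑ˡ<↑ʳ : ∀ (i : Fin m) (b : Fin (suc p)) → (i ↑ˡ suc p) Fin.< (m ↑ʳ b)
    ↑ˡ<↑ʳ i b = subst₂ ℕ._<_ (sym (Fin.toℕ-↑ˡ i (suc p))) (sym (Fin.toℕ-↑ʳ m b))
      (ℕ.<-≤-trans (Fin.toℕ<n i) (ℕ.m≤m+n m (toℕ b)))

    free-≺ : ∀ w i b → toℕ (w i) ≤ toℕ b →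
             suffix (text w) (i ↑ˡ suc p) ≺ suffix (text w) (m ↑ʳ b)
    free-≺ w i b a≤b = lookup-<⇒≺ (text w) (i ↑ˡ suc p) (m ↑ʳ b)
      (subst₂ Fin._<_ (sym (lookup-free w i)) (sym (lookup-reference w b))
        (free<reference (w i) b a≤b))

    -- First symbols decide unless they tie. A tie involves the last reference, which occupies the
    -- last position of the text, so `last-≺` settles it.
    reference-≺ : ∀ w i b → toℕ b ℕ.< toℕ (w i) →
                  suffix (text w) (m ↑ʳ b) ≺ suffix (text w) (i ↑ˡ suc p)
    reference-≺ w i b b<a with ℕ.m≤n⇒m<n∨m≡n (reference≤free (w i) b b<a)
    ... | inj₁ lt = lookup-<⇒≺ (text w) (m ↑ʳ b) (i ↑ˡ suc p)
      (subst₂ Fin._<_ (sym (lookup-reference w b)) (sym (lookup-free w i)) lt)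
    ... | inj₂ eq = last-≺ (text w) (i ↑ˡ suc p) (m ↑ʳ b)
      (begin
        suc (toℕ (m ↑ʳ b))    ≡⟨ cong suc (Fin.toℕ-↑ʳ m b) ⟩
        suc (m ℕ.+ toℕ b)     ≡⟨ ℕ.+-suc m (toℕ b) ⟨
        m ℕ.+ suc (toℕ b)     ≡⟨ cong (λ t → m ℕ.+ suc t)
                                   (reference≡free⇒last (w i) b b<a (Fin.toℕ-injective eq)) ⟩
        m ℕ.+ suc p           ∎)
      (↑ˡ<↑ʳ i b)
      (trans (lookup-reference w b) (trans (Fin.toℕ-injective eq) (sym (lookup-free w i))))
      where open ≡-Reasoning

    -- If `w i` were below `v i`, the reference with index `w i` would rank above position `i` in
    -- `text w` but below it in `text v`.
    SA⁻¹-text-≤ : ∀ w v → SA⁻¹ (text w) ≗ SA⁻¹ (text v) → ∀ i → toℕ (v i) ≤ toℕ (w i)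
    SA⁻¹-text-≤ w v eq i = ℕ.≮⇒≥ λ w<v →
      -- `w i` is a valid reference index because it is below `v i`, which is at most `suc p`.
      let b   = fromℕ< (ℕ.<-≤-trans w<v (ℕ.s≤s⁻¹ (Fin.toℕ<n (v i))))
          b≡w = Fin.toℕ-fromℕ< (ℕ.<-≤-trans w<v (ℕ.s≤s⁻¹ (Fin.toℕ<n (v i))))
      -- `SA⁻¹` unfolds to `rank`, so `rank-mono` applies to both texts.
      in Fin.<-asym
        (subst₂ Fin._<_ (eq (i ↑ˡ suc p)) (eq (m ↑ʳ b))
          (Rank.rank-mono (text w) (i ↑ˡ suc p) (m ↑ʳ b)
            (free-≺ w i b (ℕ.≤-reflexive (sym b≡w)))))
        (Rank.rank-mono (text v) (m ↑ʳ b) (i ↑ˡ suc p)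
          (reference-≺ v i b (subst (ℕ._< toℕ (v i)) (sym b≡w) w<v)))

    SA⁻¹-text-injective : ∀ w v → SA⁻¹ (text w) ≗ SA⁻¹ (text v) → w ≗ v
    SA⁻¹-text-injective w v eq i = Fin.toℕ-injective
      (ℕ.≤-antisym (SA⁻¹-text-≤ v w (sym ∘ eq) i) (SA⁻¹-text-≤ w v eq i))

    manyTexts⇒long : (D : ISADataStructure σ (m ℕ.+ suc p)) →
                     ∃ λ T → suc (suc p) ^ m ℕ.< 2 ^ suc (DataStructure.space D T)
    -- Positivity exposes the number of texts as `suc N`, the form that the pigeonhole lemma takes.
    manyTexts⇒long D with suc (suc p) ^ m in eq | ℕ.m^n>0 (suc (suc p)) m
    ... | suc N | _ = let x , lt = injective⇒long (encode ∘ T) injective in T x , lt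
      where
      open DataStructure D
      cast : Fin (suc N) → Fin (suc (suc p) ^ m)
      cast = Fin.cast (sym eq)

      T : Fin (suc N) → Text σ (m ℕ.+ suc p)
      T = text ∘ finToFun ∘ cast

      injective : Injective _≡_ _≡_ (encode ∘ T)
      injective same = Fin.toℕ-injective
        (trans (sym (Fin.toℕ-cast (sym eq) _)) (trans (cong toℕ
          (finToFun-injective (SA⁻¹-text-injective _ _ (encode-reflects-SA⁻¹ D same))))
          (Fin.toℕ-cast (sym eq) _)))

-- From the count to the space bound.

-- With c = k + 1, the bounds σ ≤ 2k + 1 ≤ c² and m + k ≤ 2m give σ^(m + k) ≤ (c^m)^4 ≤ 2^(4(s +
-- 1)). For s ≥ 1 the exponent is at most 8s, whence the factor 8; s = 0 is impossible since c^m ≥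
-- 2.
space-bound : ∀ {σ m p s} → σ ≤ suc (suc p ℕ.* 2) → suc p ≤ m →
              suc (suc p) ^ m ℕ.< 2 ^ suc s → σ ^ (m ℕ.+ suc p) ≤ 2 ^ (8 ℕ.* s)
space-bound {m = m} {p} {zero} _ p<m lt = contradiction lt (ℕ.≤⇒≯ (begin
  2                    ≤⟨ s≤s (s≤s z≤n) ⟩
  suc (suc p)          ≡⟨ ℕ.^-identityʳ (suc (suc p)) ⟨
  suc (suc p) ^ 1      ≤⟨ ℕ.^-monoʳ-≤ (suc (suc p)) (ℕ.≤-trans (s≤s z≤n) p<m) ⟩
  suc (suc p) ^ m      ∎))
  where open ℕ.≤-Reasoning
space-bound {σ} {m} {p} {suc s} σ≤ p<m lt = begin
  σ ^ (m ℕ.+ suc p)            ≤⟨ ℕ.^-monoˡ-≤ (m ℕ.+ suc p) σ≤c² ⟩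
  (c ^ 2) ^ (m ℕ.+ suc p)      ≡⟨ ℕ.^-*-assoc c 2 (m ℕ.+ suc p) ⟩
  c ^ (2 ℕ.* (m ℕ.+ suc p))    ≤⟨ ℕ.^-monoʳ-≤ c (ℕ.*-monoʳ-≤ 2 (ℕ.+-monoʳ-≤ m p<m)) ⟩
  c ^ (2 ℕ.* (m ℕ.+ m))        ≡⟨ cong (c ^_) (fourfold m) ⟩
  c ^ (m ℕ.* 4)                ≡⟨ ℕ.^-*-assoc c m 4 ⟨
  (c ^ m) ^ 4                  ≤⟨ ℕ.^-monoˡ-≤ 4 (ℕ.<⇒≤ lt) ⟩
  (2 ^ suc (suc s)) ^ 4        ≡⟨ ℕ.^-*-assoc 2 (suc (suc s)) 4 ⟩
  2 ^ (suc (suc s) ℕ.* 4)      ≤⟨ ℕ.^-monoʳ-≤ 2 (ℕ.m≤m+n (suc (suc s) ℕ.* 4) (s ℕ.* 4)) ⟩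
  2 ^ (suc (suc s) ℕ.* 4 ℕ.+ s ℕ.* 4) ≡⟨ cong (2 ^_) (eightfold s) ⟩
  2 ^ (8 ℕ.* suc s)            ∎
  where
  open ℕ.≤-Reasoning
  c = suc (suc p)

  fourfold : ∀ m → 2 ℕ.* (m ℕ.+ m) ≡ m ℕ.* 4
  fourfold = solve-∀

  eightfold : ∀ s → suc (suc s) ℕ.* 4 ℕ.+ s ℕ.* 4 ≡ 8 ℕ.* suc s
  eightfold = solve-∀

  square : ∀ k → suc (k ℕ.* 2) ℕ.+ k ℕ.* k ≡ suc k ℕ.* (suc k ℕ.* 1)
  square = solve-∀

  σ≤c² : σ ≤ c ^ 2
  σ≤c² = begin
    σ                                         ≤⟨ σ≤ ⟩
    suc (suc p ℕ.* 2)                         ≤⟨ ℕ.m≤m+n _ (suc p ℕ.* suc p) ⟩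
    suc (suc p ℕ.* 2) ℕ.+ suc p ℕ.* suc p     ≡⟨ square (suc p) ⟩
    c ^ 2                                     ∎

halve : ∀ σ → 2 ≤ σ → ∃ λ p → suc p ℕ.* 2 ≤ σ × σ ≤ suc (suc p ℕ.* 2)
halve σ 2≤σ with σ ℕ./ 2 | m/n*n≤m σ 2 | m≡m%n+[m/n]*n σ 2 | m≥n⇒m/n>0 {σ} {2} 2≤σ
... | suc p | lower | eq | _ = p , lower ,
  subst (_≤ suc (suc p ℕ.* 2)) (sym eq) (ℕ.+-monoˡ-≤ (suc p ℕ.* 2) (ℕ.s≤s⁻¹ (m%n<n σ 2)))

lowerBound : ∀ σ n → 2 ≤ σ → σ ≤ n → (D : ISADataStructure σ n) →
             ∃ λ T → σ ^ n ≤ 2 ^ (8 ℕ.* DataStructure.space D T)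
lowerBound σ n 2≤σ σ≤n D with p , lower , upper ← halve σ 2≤σ = go n≡m+1+p D
  where
  -- This gives k ≤ n - k: at least as many free positions as references.
  2k≤n : suc p ℕ.+ suc p ≤ n
  2k≤n = ℕ.≤-trans (ℕ.≤-reflexive (double (suc p))) (ℕ.≤-trans lower σ≤n)
    where
    double : ∀ k → k ℕ.+ k ≡ k ℕ.* 2
    double = solve-∀

  n≡m+1+p : n ≡ n ℕ.∸ suc p ℕ.+ suc p
  n≡m+1+p = sym (ℕ.m∸n+n≡m (ℕ.≤-trans (ℕ.m≤m+n (suc p) (suc p)) 2k≤n))

  -- Generalising the length lets `refl` retype `D` without transport.
  go : ∀ {n′} → n′ ≡ n ℕ.∸ suc p ℕ.+ suc p → (D : ISADataStructure σ n′) →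
       ∃ λ T → σ ^ n′ ≤ 2 ^ (8 ℕ.* DataStructure.space D T)
  go refl D = let open DataStructure; T , lt = References.manyTexts⇒long {σ} {p} lower D in
    T , space-bound {p = p} {space D T} upper (ℕ.m+n≤o⇒m≤o∸n (suc p) 2k≤n) lt

theorem5p7 : ∃[ δ ] (0ℚᵘ < δ) ×
    ((σ n : ℕ) → 2 ≤ σ → 2 ≤ n → σ ≤ n →
    (D : ISADataStructure σ n) →
    ∃[ T ] (δ * (+ n / 1)) *log₂ σ ≤ DataStructure.space D T)
-- The constant is 1/8, as `mkℚᵘ` stores the denominator minus one. The goal then reduces to
-- `lowerBound` up to the numerator 1 · n.
theorem5p7 = mkℚᵘ (+ 1) 7 , *<* (+<+ (s≤s z≤n)) , λ σ n 2≤σ _ σ≤n D →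
  let T , le = lowerBound σ n 2≤σ σ≤n D in
  T , subst (λ z → mkℚᵘ z 7 *log₂ σ ≤ DataStructure.space D T) (sym (ℤ.*-identityˡ (+ n))) le
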